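{- Let $p$ be a prime and $k=ap^h$ with $h\ge 0$ and $1\le a\le p-1$. Then $s(n,k)$ is a minimum zero case for every integer $n$ with $k\le n<kp$ and $(p-1)\mid(n-k)$.
   Context: $s(n,k)$ is the signed Stirling number of the first kind, defined by $x(x-1)\cdots(x-n+1)=\sum_k s(n,k)x^k$. $\nu_p$ is the $p$-adic valuation and $\sigma_p(m)$ the base-$p$ digit sum. $s(n,k)$ is called a minimum zero case if $\nu_p(s(n,k))=(\sigma_p(k-1)-\sigma_p(n-1))/(p-1)$. -}

module Defs where

open import Data.Nat using (ℕ; zero; suc; _+_; _*_; _∸_; _^_; _<_; NonZero)
open import Data.Nat.DivMod using (_/_; _%_)
open import Data.Integer as ℤ using (ℤ; +_; -_)
open import Data.Integer.Divisibility using () renaming (_∣_ to _∣ℤ_)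
open import Data.Product using (_×_)
open import Relation.Nullary using (¬_)

-- Signed Stirling numbers of the first kind:
-- x(x-1)...(x-n+1) = Σ_k s(n,k) x^k, hence
-- s(n+1,k+1) = s(n,k) - n * s(n,k+1), s(0,0)=1, s(0,k+1)=0, s(n+1,0)=0.
stirling1 : ℕ → ℕ → ℤ
stirling1 zero    zero    = + 1
stirling1 zero    (suc k) = + 0
stirling1 (suc n) zero    = + 0
stirling1 (suc n) (suc k) = stirling1 n k ℤ.- (+ n) ℤ.* stirling1 n (suc k)

-- Base-p digit sum, computed with fuel (fuel m suffices for m, since p ≥ 2).
digitSumFuel : (p : ℕ) → .{{NonZero p}} → ℕ → ℕ → ℕ
digitSumFuel p zero       m = 0
digitSumFuel p (suc fuel) m = m % p + digitSumFuel p fuel (m / p)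

digitSum : (p : ℕ) → .{{NonZero p}} → ℕ → ℕ
digitSum p m = digitSumFuel p m m

IsPAdicVal : ℕ → ℤ → ℕ → Set
IsPAdicVal p x v = ((+ (p ^ v)) ∣ℤ x) × ¬ ((+ (p ^ suc v)) ∣ℤ x)

{-# OPTIONS --safe #-}
-- Write n = N + 1, k = K + 1. Up to the factor N!/K!, s(n, k) is the coefficient of t^N in
-- log(1+t)^K / (1+t). After the rescaling t = π u with π^(p-1) = ± p, the series
-- log(1+π u)/π reduces modulo π to u ± u^p, because v(i) ≤ (i-1)/(p-1) with equality only
-- for i = 1 and i = p, while 1/(1+π u) reduces to 1. Hence for N = K + (p-1) j the rescaled
-- coefficient reduces to ± C(K, j), which is a unit when K + 1 = a p^h and j ≤ K.
-- Legendre's formula for v(N!) and v(K!) turns this into the digit-sum formula.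
-- The ramified uniformiser π is avoided by recording only integral powers of p: the exponent
-- (N - K)/(p-1) of p is rounded up, and the coefficients that are not on the lattice
-- N ≡ K mod p-1 then vanish modulo p.
module Submission where

open import Defs
open import Data.Nat using (ℕ; zero; suc; _+_; _*_; _∸_; _^_; _!; _≤_; _<_; _>_; z≤n; s≤s; NonZero; nonTrivial⇒n>1; >-nonZero)
open import Data.Nat.Combinatorics using (_C_; nC1≡n; nCk+nC[k+1]≡[n+1]C[k+1]; k>n⇒nCk≡0)
open import Data.Nat.Divisibility using (_∣_; _∤_; divides; m∣m*n; ∣⇒≤)
import Data.Nat.Divisibility as ℕ∣
open import Data.Nat.DivMod using (_/_; _%_; m≡m%n+[m/n]*n; m%n<n; m/n<m; [m+kn]%n≡m%n; m<n⇒m%n≡m; m*n/n≡m; m<n⇒m/n≡0; +-distrib-/-∣ʳ)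
open import Data.Nat.Induction using (<-rec)
open import Data.Nat.Primality using (Prime; euclidsLemma; prime⇒nonTrivial)
open import Data.Nat.Properties using (_≟_; +-suc)
import Data.Nat.Properties as ℕₚ
import Data.Nat.Tactic.RingSolver as ℕ-Solver
open import Data.Integer as ℤ using (ℤ; +_; -_)
import Data.Integer.Divisibility.Signed as ℤ∣
import Data.Integer.Properties as ℤₚ
import Data.Integer.Tactic.RingSolver as ℤ-Solver
open import Data.Product using (Σ; ∃; ∃₂; _×_; _,_; proj₁; proj₂)
open import Data.Sum using (inj₁; inj₂; [_,_]′)
open import Relation.Nullary using (yes; no; contradiction)
open import Relation.Binary.PropositionalEquality using (_≡_; _≢_; refl; sym; trans; cong; cong₂; subst; module ≡-Reasoning)

-- Finite sums along an antidiagonal.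

-- Σ f m′ i over m′ + i = m + b with i ≥ b.
diagSum : (ℕ → ℕ → ℤ) → ℕ → ℕ → ℤ
diagSum f zero    b = f 0 b
diagSum f (suc m) b = f (suc m) b ℤ.+ diagSum f m (suc b)

-- The hypothesis is restricted to the antidiagonal because `stirling1-log` needs it there to split
-- the constant `2 + m` as `suc m′ + suc i`.
diagSum-lin : ∀ (f g h : ℕ → ℕ → ℤ) c m b →
  (∀ m′ i → m′ + i ≡ m + b → f m′ i ℤ.- c ℤ.* g m′ i ≡ h m′ i) →
  diagSum f m b ℤ.- c ℤ.* diagSum g m b ≡ diagSum h m b
diagSum-lin f g h c zero    b eq = eq 0 b refl
diagSum-lin f g h c (suc m) b eq = begin
  (f (suc m) b ℤ.+ diagSum f m (suc b)) ℤ.- c ℤ.* (g (suc m) b ℤ.+ diagSum g m (suc b))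
    ≡⟨ regroup (f (suc m) b) (diagSum f m (suc b)) c (g (suc m) b) (diagSum g m (suc b)) ⟩
  (f (suc m) b ℤ.- c ℤ.* g (suc m) b) ℤ.+ (diagSum f m (suc b) ℤ.- c ℤ.* diagSum g m (suc b))
    ≡⟨ cong₂ ℤ._+_ (eq (suc m) b refl)
         (diagSum-lin f g h c m (suc b) λ m′ i e → eq m′ i (trans e (+-suc m b))) ⟩
  h (suc m) b ℤ.+ diagSum h m (suc b) ∎
  where
  open ≡-Reasoning
  regroup : ∀ x y c z w → (x ℤ.+ y) ℤ.- c ℤ.* (z ℤ.+ w) ≡ (x ℤ.- c ℤ.* z) ℤ.+ (y ℤ.- c ℤ.* w)
  regroup = ℤ-Solver.solve-∀

diagSum-*ˡ : ∀ c f g m b → (∀ m′ i → c ℤ.* f m′ i ≡ g m′ i) → c ℤ.* diagSum f m b ≡ diagSum g m b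
diagSum-*ˡ c f g zero    b eq = eq 0 b
diagSum-*ˡ c f g (suc m) b eq =
  trans (ℤₚ.*-distribˡ-+ c (f (suc m) b) (diagSum f m (suc b)))
        (cong₂ ℤ._+_ (eq (suc m) b) (diagSum-*ˡ c f g m (suc b) eq))

diagSum-0 : ∀ f m b → (∀ m′ i → f m′ i ≡ + 0) → diagSum f m b ≡ + 0
diagSum-0 f zero    b eq = eq 0 b
diagSum-0 f (suc m) b eq = cong₂ ℤ._+_ (eq (suc m) b) (diagSum-0 f m (suc b) eq)

-- Signs and integral weights of the logarithm series.

sgn : ℕ → ℤ
sgn zero    = + 1
sgn (suc i) = - sgn i

-- logCoeff m i = (m + i + 1)! / (m! (i + 1)): up to sign, the weight with which the
-- term t^(i+1)/(i+1) of log (1 + t) enters a product of exponential generating functions.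
logCoeff : ℕ → ℕ → ℕ
logCoeff zero    i       = i !
logCoeff (suc m) zero    = suc (logCoeff m zero)
logCoeff (suc m) (suc i) = logCoeff m (suc i) + suc i * logCoeff (suc m) i

-- After clearing denominators, the last clause of the recursion reads `(m + i + 3)! = ((m + 1) + (i
-- + 2)) (m + i + 2)!`.
logCoeff-! : ∀ m i → logCoeff m i * (m ! * suc i) ≡ suc (m + i) !
logCoeff-! zero    i       = lem (i !) i
  where
  lem : ∀ f i → f * (1 * suc i) ≡ suc i * f
  lem = ℕ-Solver.solve-∀
logCoeff-! (suc m) zero    = begin
  suc (logCoeff m 0) * (suc m * m ! * 1)
    ≡⟨ lem (logCoeff m 0) m (m !) ⟩
  suc m * (logCoeff m 0 * (m ! * 1)) + suc m * m !
    ≡⟨ cong (λ x → suc m * x + suc m * m !) (logCoeff-! m 0) ⟩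
  suc m * suc (m + 0) ! + suc m * m !
    ≡⟨ cong (λ x → suc m * suc x ! + suc m * m !) (ℕₚ.+-identityʳ m) ⟩
  suc m * (suc m * m !) + suc m * m !
    ≡⟨ lem′ m (m !) ⟩
  suc (suc m) * (suc m * m !)
    ≡⟨ cong (λ x → suc (suc x) * (suc x * x !)) (ℕₚ.+-identityʳ m) ⟨
  suc (suc (m + 0)) ! ∎
  where
  open ≡-Reasoning
  lem : ∀ l m f → suc l * (suc m * f * 1) ≡ suc m * (l * (f * 1)) + suc m * f
  lem = ℕ-Solver.solve-∀
  lem′ : ∀ m f → suc m * (suc m * f) + suc m * f ≡ suc (suc m) * (suc m * f)
  lem′ = ℕ-Solver.solve-∀
logCoeff-! (suc m) (suc i) = begin
  (logCoeff m (suc i) + suc i * logCoeff (suc m) i) * (suc m * m ! * suc (suc i))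
    ≡⟨ lem (logCoeff m (suc i)) (logCoeff (suc m) i) i m (m !) ⟩
  suc m * (logCoeff m (suc i) * (m ! * suc (suc i)))
    + suc (suc i) * (logCoeff (suc m) i * (suc m * m ! * suc i))
    ≡⟨ cong₂ (λ x y → suc m * x + suc (suc i) * y) (logCoeff-! m (suc i)) (logCoeff-! (suc m) i) ⟩
  suc m * suc (m + suc i) ! + suc (suc i) * suc (suc m + i) !
    ≡⟨ cong (λ x → suc m * suc (m + suc i) ! + suc (suc i) * suc x !) (+-suc m i) ⟨
  suc m * suc (m + suc i) ! + suc (suc i) * suc (m + suc i) !
    ≡⟨ lem′ m i (suc (m + suc i) !) ⟩
  suc (suc (m + suc i)) ! ∎
  where
  open ≡-Reasoning
  lem : ∀ a b i m f → (a + suc i * b) * (suc m * f * suc (suc i))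
      ≡ suc m * (a * (f * suc (suc i))) + suc (suc i) * (b * (suc m * f * suc i))
  lem = ℕ-Solver.solve-∀
  lem′ : ∀ m i x → suc m * x + suc (suc i) * x ≡ suc (suc (m + suc i)) * x
  lem′ = ℕ-Solver.solve-∀

-- The recurrence for Stirling numbers given by multiplication with log(1+t).

logTerm : (ℕ → ℤ) → ℕ → ℕ → ℤ
logTerm σ m i = sgn i ℤ.* + logCoeff m i ℤ.* σ m

shiftedLogTerm : (ℕ → ℤ) → ℕ → ℕ → ℤ
shiftedLogTerm σ m i = sgn i ℤ.* + logCoeff m i ℤ.* (σ (suc m) ℤ.- + suc i ℤ.* σ m)

logCoeff-step : ℕ → ℕ → ℕ
logCoeff-step m zero    = 1
logCoeff-step m (suc i) = suc i * logCoeff (suc m) i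

logCoeff-suc : ∀ m i → logCoeff (suc m) i ≡ logCoeff m i + logCoeff-step m i
logCoeff-suc m zero    = ℕₚ.+-comm 1 (logCoeff m zero)

logCoeff-suc m (suc i) = refl

pos-split : ∀ {x} y z → x ≡ y + z → + x ≡ + y ℤ.+ + z
pos-split y z eq = trans (cong +_ eq) (ℤₚ.pos-+ y z)

-- Each shifted term splits in two: the `σ (suc m)` half keeps its index `i`, while the
-- `suc i * σ m` half moves to index `suc i` and supplies `logCoeff-step` there. The first index `b`
-- receives no such half, so its increment is added separately.
diagSum-shift : ∀ σ m b →
  diagSum (shiftedLogTerm σ) m b ℤ.+ sgn b ℤ.* + logCoeff-step m b ℤ.* σ (suc m)
    ≡ diagSum (logTerm σ) (suc m) b
diagSum-shift σ zero b = begin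
  sgn b ℤ.* + logCoeff 0 b ℤ.* (σ 1 ℤ.- + suc b ℤ.* σ 0) ℤ.+ sgn b ℤ.* + logCoeff-step 0 b ℤ.* σ 1
    ≡⟨ lem (sgn b) (+ logCoeff 0 b) (+ logCoeff-step 0 b) (+ suc b) (σ 1) (σ 0) ⟩
  sgn b ℤ.* (+ logCoeff 0 b ℤ.+ + logCoeff-step 0 b) ℤ.* σ 1 ℤ.+ - sgn b ℤ.* (+ suc b ℤ.* + logCoeff 0 b) ℤ.* σ 0
    ≡⟨ cong₂ (λ x y → sgn b ℤ.* x ℤ.* σ 1 ℤ.+ - sgn b ℤ.* y ℤ.* σ 0)
         (sym (pos-split (logCoeff 0 b) (logCoeff-step 0 b) (logCoeff-suc 0 b))) (sym (ℤₚ.pos-* (suc b) (b !))) ⟩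
  diagSum (logTerm σ) 1 b ∎
  where
  open ≡-Reasoning
  lem : ∀ s q e c x y → s ℤ.* q ℤ.* (x ℤ.- c ℤ.* y) ℤ.+ s ℤ.* e ℤ.* x
      ≡ s ℤ.* (q ℤ.+ e) ℤ.* x ℤ.+ - s ℤ.* (c ℤ.* q) ℤ.* y
  lem = ℤ-Solver.solve-∀
diagSum-shift σ (suc m) b = begin
  (sgn b ℤ.* + logCoeff (suc m) b ℤ.* (σ (2 + m) ℤ.- + suc b ℤ.* σ (suc m)) ℤ.+ diagSum (shiftedLogTerm σ) m (suc b))
    ℤ.+ sgn b ℤ.* + logCoeff-step (suc m) b ℤ.* σ (2 + m)
    ≡⟨ lem (sgn b) (+ logCoeff (suc m) b) (+ logCoeff-step (suc m) b) (+ suc b) (σ (2 + m)) (σ (suc m)) _ ⟩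
  sgn b ℤ.* (+ logCoeff (suc m) b ℤ.+ + logCoeff-step (suc m) b) ℤ.* σ (2 + m)
    ℤ.+ (diagSum (shiftedLogTerm σ) m (suc b) ℤ.+ - sgn b ℤ.* (+ suc b ℤ.* + logCoeff (suc m) b) ℤ.* σ (suc m))
    ≡⟨ cong₂ (λ x y → sgn b ℤ.* x ℤ.* σ (2 + m) ℤ.+ (diagSum (shiftedLogTerm σ) m (suc b) ℤ.+ - sgn b ℤ.* y ℤ.* σ (suc m)))
         (sym (pos-split (logCoeff (suc m) b) (logCoeff-step (suc m) b) (logCoeff-suc (suc m) b))) (sym (ℤₚ.pos-* (suc b) (logCoeff (suc m) b))) ⟩
  logTerm σ (2 + m) b
    ℤ.+ (diagSum (shiftedLogTerm σ) m (suc b) ℤ.+ sgn (suc b) ℤ.* + logCoeff-step m (suc b) ℤ.* σ (suc m))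
    ≡⟨ cong (ℤ._+_ (logTerm σ (2 + m) b)) (diagSum-shift σ m (suc b)) ⟩
  diagSum (logTerm σ) (2 + m) b ∎
  where
  open ≡-Reasoning
  lem : ∀ s q e c x y d → (s ℤ.* q ℤ.* (x ℤ.- c ℤ.* y) ℤ.+ d) ℤ.+ s ℤ.* e ℤ.* x
      ≡ s ℤ.* (q ℤ.+ e) ℤ.* x ℤ.+ (d ℤ.+ - s ℤ.* (c ℤ.* q) ℤ.* y)
  lem = ℤ-Solver.solve-∀

-- Coefficientwise, d/dy (1+t)^y = log (1+t) (1+t)^y.
stirling1-log : ∀ m K →
  + K ℤ.* stirling1 (2 + m) (suc K) ≡ diagSum (logTerm (λ i → stirling1 (suc i) K)) m 0
stirling1-log m zero = sym (diagSum-0 _ m 0 λ m′ i → ℤₚ.*-zeroʳ (sgn i ℤ.* + logCoeff m′ i))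
stirling1-log zero (suc zero) = refl
stirling1-log zero (suc (suc K)) = ℤₚ.*-zeroʳ (+ suc (suc K))
stirling1-log (suc m) (suc K) = begin
  + suc K ℤ.* (s ℤ.- + (2 + m) ℤ.* s′)
    -- Splitting `suc K` as `K + 1` leaves `K * s` for the induction hypothesis; the spare `s` is
    -- the boundary term of `diagSum-shift` at `b = 0`.
    ≡⟨ lem (+ K) s (+ (2 + m)) s′ ⟩
  (+ K ℤ.* s ℤ.- + (2 + m) ℤ.* (+ suc K ℤ.* s′)) ℤ.+ + 1 ℤ.* + 1 ℤ.* s
    ≡⟨ cong₂ (λ x y → (x ℤ.- + (2 + m) ℤ.* y) ℤ.+ + 1 ℤ.* + 1 ℤ.* s) (stirling1-log m K) (stirling1-log m (suc K)) ⟩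
  (diagSum (logTerm (λ i → stirling1 (suc i) K)) m 0 ℤ.- + (2 + m) ℤ.* diagSum (logTerm σ) m 0) ℤ.+ + 1 ℤ.* + 1 ℤ.* s
    ≡⟨ cong (ℤ._+ + 1 ℤ.* + 1 ℤ.* s) (diagSum-lin _ _ (shiftedLogTerm σ) (+ (2 + m)) m 0 pointwise) ⟩
  diagSum (shiftedLogTerm σ) m 0 ℤ.+ + 1 ℤ.* + 1 ℤ.* s
    ≡⟨ diagSum-shift σ m 0 ⟩
  diagSum (logTerm σ) (suc m) 0 ∎
  where
  open ≡-Reasoning
  σ : ℕ → ℤ
  σ i = stirling1 (suc i) (suc K)
  s s′ : ℤ
  s  = stirling1 (2 + m) (suc K)
  s′ = stirling1 (2 + m) (2 + K)
  lem : ∀ k x c y → (+ 1 ℤ.+ k) ℤ.* (x ℤ.- c ℤ.* y) ≡ (k ℤ.* x ℤ.- c ℤ.* ((+ 1 ℤ.+ k) ℤ.* y)) ℤ.+ + 1 ℤ.* + 1 ℤ.* x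
  lem = ℤ-Solver.solve-∀
  regroup : ∀ a q x y c d → a ℤ.* q ℤ.* x ℤ.- (c ℤ.+ d) ℤ.* (a ℤ.* q ℤ.* y) ≡ a ℤ.* q ℤ.* ((x ℤ.- c ℤ.* y) ℤ.- d ℤ.* y)
  regroup = ℤ-Solver.solve-∀
  pointwise : ∀ m′ i → m′ + i ≡ m + 0 →
    logTerm (λ i → stirling1 (suc i) K) m′ i ℤ.- + (2 + m) ℤ.* logTerm σ m′ i ≡ shiftedLogTerm σ m′ i
  pointwise m′ i eq = trans
    (cong (λ c → logTerm (λ i → stirling1 (suc i) K) m′ i ℤ.- c ℤ.* logTerm σ m′ i) (pos-split (suc m′) (suc i) index))
    (regroup (sgn i) (+ logCoeff m′ i) (stirling1 (suc m′) K) (stirling1 (suc m′) (suc K)) (+ suc m′) (+ suc i))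
    where
    index : 2 + m ≡ suc m′ + suc i
    index = trans (cong (λ x → suc (suc x)) (trans (sym (ℕₚ.+-identityʳ m)) (sym eq))) (cong suc (sym (+-suc m′ i)))

-- Special values of the Stirling numbers.

stirling1-< : ∀ {n k} → n < k → stirling1 n k ≡ + 0
stirling1-< {zero}  {suc k} _         = refl
stirling1-< {suc n} {suc k} (s≤s n<k) =
  trans (cong₂ (λ x y → x ℤ.- + n ℤ.* y) (stirling1-< n<k) (stirling1-< (ℕₚ.m<n⇒m<1+n n<k)))
        (cong (λ x → + 0 ℤ.- x) (ℤₚ.*-zeroʳ (+ n)))

stirling1-1 : ∀ n → stirling1 (suc n) 1 ≡ sgn n ℤ.* + (n !)
stirling1-1 zero    = refl
stirling1-1 (suc n) = begin
  + 0 ℤ.- + suc n ℤ.* stirling1 (suc n) 1      ≡⟨ cong (λ x → + 0 ℤ.- + suc n ℤ.* x) (stirling1-1 n) ⟩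
  + 0 ℤ.- + suc n ℤ.* (sgn n ℤ.* + (n !))      ≡⟨ lem (+ suc n) (sgn n) (+ (n !)) ⟩
  - sgn n ℤ.* (+ suc n ℤ.* + (n !))            ≡⟨ cong (- sgn n ℤ.*_) (ℤₚ.pos-* (suc n) (n !)) ⟨
  sgn (suc n) ℤ.* + (suc n !)                  ∎
  where
  open ≡-Reasoning
  lem : ∀ a b c → + 0 ℤ.- a ℤ.* (b ℤ.* c) ≡ - b ℤ.* (a ℤ.* c)
  lem = ℤ-Solver.solve-∀

-- Divisibility in the integers localised at `p = suc r`.

module AtPrime (r : ℕ) (p-prime : Prime (suc r)) where

  p : ℕ
  p = suc r

  0<r : 0 < r
  0<r = ℕₚ.≤-pred (nonTrivial⇒n>1 p {{prime⇒nonTrivial p-prime}})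

  p∤1 : p ∤ 1
  p∤1 p∣1 = ℕₚ.<⇒≱ (s≤s 0<r) (∣⇒≤ p∣1)

  p∤* : ∀ {m n} → p ∤ m → p ∤ n → p ∤ m * n
  p∤* {m} {n} p∤m p∤n p∣mn = [ p∤m , p∤n ]′ (euclidsLemma m n p-prime p∣mn)

  -- Divisibility in the localisation of ℤ at p.
  infix 4 _∣ₗ_
  record _∣ₗ_ (M x : ℤ) : Set where
    constructor over
    field
      denominator   : ℕ
      p∤denominator : p ∤ denominator
      divisible     : M ℤ∣.∣ + denominator ℤ.* x

  ∣ₗ-resp : ∀ {M M′ x x′} → M ≡ M′ → x ≡ x′ → M ∣ₗ x → M′ ∣ₗ x′
  ∣ₗ-resp refl refl M∣x = M∣x

  ∣ₗ-0 : ∀ {M} → M ∣ₗ + 0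
  ∣ₗ-0 = over 1 p∤1 (ℤ∣.divides (+ 0) refl)

  ∣ₗ-+ : ∀ {M x y} → M ∣ₗ x → M ∣ₗ y → M ∣ₗ x ℤ.+ y
  ∣ₗ-+ {M} {x} {y} (over u p∤u M∣ux) (over v p∤v M∣vy) = over (u * v) (p∤* p∤u p∤v)
    (subst (M ℤ∣.∣_) (trans (lem (+ u) (+ v) x y) (cong (ℤ._* (x ℤ.+ y)) (sym (ℤₚ.pos-* u v))))
      (ℤ∣.∣m∣n⇒∣m+n (ℤ∣.∣n⇒∣m*n (+ v) M∣ux) (ℤ∣.∣n⇒∣m*n (+ u) M∣vy)))
    where
    lem : ∀ u v x y → v ℤ.* (u ℤ.* x) ℤ.+ u ℤ.* (v ℤ.* y) ≡ u ℤ.* v ℤ.* (x ℤ.+ y)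
    lem = ℤ-Solver.solve-∀

  ∣ₗ-*ˡ : ∀ {M x} c → M ∣ₗ x → M ∣ₗ c ℤ.* x
  ∣ₗ-*ˡ {M} {x} c (over u p∤u M∣ux) = over u p∤u (subst (M ℤ∣.∣_) (lem c (+ u) x) (ℤ∣.∣n⇒∣m*n c M∣ux))
    where
    lem : ∀ c u x → c ℤ.* (u ℤ.* x) ≡ u ℤ.* (c ℤ.* x)
    lem = ℤ-Solver.solve-∀

  ∣ₗ-mono : ∀ {M x} c → M ∣ₗ x → c ℤ.* M ∣ₗ c ℤ.* x
  ∣ₗ-mono {M} {x} c (over u p∤u M∣ux) = over u p∤u (subst (c ℤ.* M ℤ∣.∣_) (lem c (+ u) x) (ℤ∣.*-monoʳ-∣ c M∣ux))
    where
    lem : ∀ c u x → c ℤ.* (u ℤ.* x) ≡ u ℤ.* (c ℤ.* x)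
    lem = ℤ-Solver.solve-∀

  ∣ₗ-unit : ∀ {M x} v → p ∤ v → M ∣ₗ + v ℤ.* x → M ∣ₗ x
  ∣ₗ-unit {M} {x} v p∤v (over u p∤u M∣uvx) = over (u * v) (p∤* p∤u p∤v)
    (subst (M ℤ∣.∣_) (trans (sym (ℤₚ.*-assoc (+ u) (+ v) x)) (cong (ℤ._* x) (sym (ℤₚ.pos-* u v)))) M∣uvx)

  ∣ₗ-multiple : ∀ M c → M ∣ₗ c ℤ.* M
  ∣ₗ-multiple M c = over 1 p∤1 (ℤ∣.divides c (ℤₚ.*-identityˡ (c ℤ.* M)))

  ∣ₗ-diagSum : ∀ {M} f m b →
    (∀ m′ i → m′ + i ≡ m + b → b ≤ i → M ∣ₗ f m′ i) → M ∣ₗ diagSum f m b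
  ∣ₗ-diagSum f zero    b h = h 0 b refl ℕₚ.≤-refl
  ∣ₗ-diagSum f (suc m) b h = ∣ₗ-+ (h (suc m) b refl ℕₚ.≤-refl)
    (∣ₗ-diagSum f m (suc b) λ m′ i eq b<i → h m′ i (trans eq (ℕₚ.+-suc m b)) (ℕₚ.<⇒≤ b<i))

  -- Isolates the one summand that need not vanish modulo `M`. In `logPower-suc` the index `c` is 0
  -- or `r`, for the terms t and t^p/p of the logarithm.
  ∣ₗ-diagSum-except : ∀ {M} f m b m₀ c → b ≤ c → m₀ + c ≡ m + b →
    (∀ m′ i → m′ + i ≡ m + b → b ≤ i → i ≢ c → M ∣ₗ f m′ i) → M ∣ₗ diagSum f m b ℤ.- f m₀ c
  ∣ₗ-diagSum-except {M} f m b m₀ c b≤c eq h with b ≟ c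
  ∣ₗ-diagSum-except {M} f zero    b m₀ c b≤c eq h | yes refl with refl ← ℕₚ.+-cancelʳ-≡ b m₀ 0 eq =
    subst (M ∣ₗ_) (sym (ℤₚ.+-inverseʳ (f 0 b))) ∣ₗ-0
  ∣ₗ-diagSum-except {M} f (suc m) b m₀ c b≤c eq h | yes refl with refl ← ℕₚ.+-cancelʳ-≡ b m₀ (suc m) eq =
    subst (M ∣ₗ_) (lem (f (suc m) b) (diagSum f m (suc b)))
      (∣ₗ-diagSum f m (suc b) λ m′ i eq′ b<i →
        h m′ i (trans eq′ (ℕₚ.+-suc m b)) (ℕₚ.<⇒≤ b<i) (λ { refl → ℕₚ.<-irrefl refl b<i }))
    where
    lem : ∀ x y → y ≡ (x ℤ.+ y) ℤ.- x
    lem = ℤ-Solver.solve-∀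
  ∣ₗ-diagSum-except {M} f zero    b m₀ c b≤c eq h | no b≢c =
    contradiction (ℕₚ.≤-antisym b≤c (ℕₚ.≤-trans (ℕₚ.m≤n+m c m₀) (ℕₚ.≤-reflexive eq))) b≢c
  ∣ₗ-diagSum-except {M} f (suc m) b m₀ c b≤c eq h | no b≢c =
    subst (M ∣ₗ_) (lem (f (suc m) b) (diagSum f m (suc b)) (f m₀ c))
      (∣ₗ-+ (h (suc m) b refl ℕₚ.≤-refl b≢c)
        (∣ₗ-diagSum-except f m (suc b) m₀ c (ℕₚ.≤∧≢⇒< b≤c b≢c) (trans eq (sym (ℕₚ.+-suc m b)))
          λ m′ i eq′ b<i → h m′ i (trans eq′ (ℕₚ.+-suc m b)) (ℕₚ.<⇒≤ b<i)))
    where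
    lem : ∀ x y z → x ℤ.+ (y ℤ.- z) ≡ (x ℤ.+ y) ℤ.- z
    lem = ℤ-Solver.solve-∀

  -- Digit sums and Legendre's formula.

  digitSumFuel-irrelevant : ∀ f g m → m ≤ f → m ≤ g → digitSumFuel p f m ≡ digitSumFuel p g m
  digitSumFuel-irrelevant zero    zero    m       m≤f m≤g = refl
  digitSumFuel-irrelevant zero    (suc g) zero    m≤f m≤g = digitSumFuel-irrelevant 0 g 0 z≤n z≤n
  digitSumFuel-irrelevant (suc f) zero    zero    m≤f m≤g = digitSumFuel-irrelevant f 0 0 z≤n z≤n
  digitSumFuel-irrelevant (suc f) (suc g) zero    m≤f m≤g = digitSumFuel-irrelevant f g 0 z≤n z≤n
  digitSumFuel-irrelevant (suc f) (suc g) (suc m) (s≤s m≤f) (s≤s m≤g) =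
    cong (λ x → suc m % p + x) (digitSumFuel-irrelevant f g (suc m / p)
      (ℕₚ.≤-trans quotient≤ m≤f) (ℕₚ.≤-trans quotient≤ m≤g))
    where
    quotient≤ : suc m / p ≤ m
    quotient≤ = ℕₚ.≤-pred (m/n<m (suc m) p (s≤s 0<r))

  digitSum-+* : ∀ s M → s < p → digitSum p (s + M * p) ≡ s + digitSum p M
  digitSum-+* s M s<p = begin
    digitSum p N                              ≡⟨ digitSumFuel-irrelevant N (suc N) N ℕₚ.≤-refl (ℕₚ.n≤1+n N) ⟩
    N % p + digitSumFuel p N (N / p)          ≡⟨ cong₂ (λ x y → x + digitSumFuel p N y) rem quot ⟩
    s + digitSumFuel p N M                    ≡⟨ cong (λ x → s + x) (digitSumFuel-irrelevant N M M M≤N ℕₚ.≤-refl) ⟩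
    s + digitSum p M                          ∎
    where
    open ≡-Reasoning
    N : ℕ
    N = s + M * p
    rem : N % p ≡ s
    rem = trans ([m+kn]%n≡m%n s M p) (m<n⇒m%n≡m s<p)
    quot : N / p ≡ M
    quot = trans (+-distrib-/-∣ʳ s (divides M refl)) (cong₂ _+_ (m<n⇒m/n≡0 s<p) (m*n/n≡m M p))
    M≤N : M ≤ N
    M≤N = ℕₚ.≤-trans (ℕₚ.m≤m*n M p) (ℕₚ.m≤n+m (M * p) s)

  -- w is the number of carries in the base-p addition n + 1.
  valuation-suc : ∀ n → ∃₂ λ w m → suc n ≡ p ^ w * m × p ∤ m × digitSum p (suc n) + r * w ≡ suc (digitSum p n)
  valuation-suc = <-rec _ step
    where
    Goal : ℕ → Set
    Goal n = ∃₂ λ w m → suc n ≡ p ^ w * m × p ∤ m × digitSum p (suc n) + r * w ≡ suc (digitSum p n)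
    -- The recursive call is guarded because `M < s + M * p` fails for `s = M = 0`; it is only made
    -- when `s = r > 0`.
    byDigit : ∀ s M → s < p → (s + M * p > M → Goal M) → Goal (s + M * p)
    byDigit s M s<p rec with suc s ≟ p
    -- The last digit is below `r`: there is no carry and `suc n` is prime to `p`.
    ... | no s+1≢p = 0 , suc (s + M * p) , sym (ℕₚ.*-identityˡ _) , p∤ ,
      (begin
        digitSum p (suc s + M * p) + r * 0   ≡⟨ cong₂ _+_ (digitSum-+* (suc s) M s+1<p) (ℕₚ.*-zeroʳ r) ⟩
        suc s + digitSum p M + 0             ≡⟨ ℕₚ.+-identityʳ _ ⟩
        suc (s + digitSum p M)               ≡⟨ cong suc (digitSum-+* s M s<p) ⟨
        suc (digitSum p (s + M * p))         ∎)
      where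
      open ≡-Reasoning
      s+1<p : suc s < p
      s+1<p = ℕₚ.≤∧≢⇒< s<p s+1≢p
      p∤ : p ∤ suc (s + M * p)
      p∤ p∣ = ℕₚ.<⇒≱ s+1<p (∣⇒≤ (ℕ∣.∣m+n∣m⇒∣n (subst (p ∣_) (ℕₚ.+-comm (suc s) (M * p)) p∣) (divides M refl)))
    -- The last digit is `r`: it becomes 0, and the carry into `M` accounts for one more power of
    -- `p`.
    ... | yes refl with rec (ℕₚ.+-mono-≤ 0<r (ℕₚ.m≤m*n M p))
    ... | w , m , eq , p∤m , σ-eq = suc w , m ,
      trans (cong (_* p) eq) (lem (p ^ w) m p) , p∤m ,
      (begin
        digitSum p (suc M * p) + r * suc w   ≡⟨ cong (_+ r * suc w) (digitSum-+* 0 (suc M) (s≤s z≤n)) ⟩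
        digitSum p (suc M) + r * suc w       ≡⟨ lem′ (digitSum p (suc M)) r w ⟩
        r + (digitSum p (suc M) + r * w)     ≡⟨ cong (λ x → r + x) σ-eq ⟩
        r + suc (digitSum p M)               ≡⟨ ℕₚ.+-suc r _ ⟩
        suc (r + digitSum p M)               ≡⟨ cong suc (digitSum-+* r M s<p) ⟨
        suc (digitSum p (r + M * p))         ∎)
      where
      open ≡-Reasoning
      lem : ∀ a b c → a * b * c ≡ c * a * b
      lem = ℕ-Solver.solve-∀
      lem′ : ∀ d r w → d + r * suc w ≡ r + (d + r * w)
      lem′ = ℕ-Solver.solve-∀
    step : ∀ n → (∀ {m} → m < n → Goal m) → Goal n
    step n rec = subst Goal (sym (m≡m%n+[m/n]*n n p))
      (byDigit (n % p) (n / p) (m%n<n n p)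
        (λ M< → rec (subst (n / p <_) (sym (m≡m%n+[m/n]*n n p)) M<)))

  -- Summing `valuation-suc` over the factors of the factorial telescopes the digit sums.
  legendre : ∀ n → ∃₂ λ v u → n ! ≡ p ^ v * u × p ∤ u × digitSum p n + r * v ≡ n
  legendre zero = 0 , 1 , refl , p∤1 , ℕₚ.*-zeroʳ r
  legendre (suc n) with valuation-suc n | legendre n
  ... | w , m , eq , p∤m , σ-eq | v , u , eq′ , p∤u , σ-eq′ = w + v , m * u ,
    (begin
      suc n * n !                  ≡⟨ cong₂ _*_ eq eq′ ⟩
      p ^ w * m * (p ^ v * u)      ≡⟨ lem (p ^ w) m (p ^ v) u ⟩
      p ^ w * p ^ v * (m * u)      ≡⟨ cong (_* (m * u)) (ℕₚ.^-distribˡ-+-* p w v) ⟨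
      p ^ (w + v) * (m * u)        ∎) ,
    p∤* p∤m p∤u ,
    (begin
      digitSum p (suc n) + r * (w + v)       ≡⟨ lem′ (digitSum p (suc n)) r w v ⟩
      digitSum p (suc n) + r * w + r * v     ≡⟨ cong (_+ r * v) σ-eq ⟩
      suc (digitSum p n + r * v)             ≡⟨ cong suc σ-eq′ ⟩
      suc n                                  ∎)
    where
    open ≡-Reasoning
    lem : ∀ a b c d → a * b * (c * d) ≡ a * c * (b * d)
    lem = ℕ-Solver.solve-∀
    lem′ : ∀ d r w v → d + r * (w + v) ≡ d + r * w + r * v
    lem′ = ℕ-Solver.solve-∀

  -- Coefficients of powers of the logarithm modulo `p`.

  -- X N K = N! · [t^N] log(1+t)^K / (1+t).
  X : ℕ → ℕ → ℤ
  X N K = + (K !) ℤ.* stirling1 (suc N) (suc K)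

  -- The coefficient of y^j in (1 + ε y)^K, where ε y = sgn r · t^p / (p t) is the only term of
  -- log(1+t)/t besides 1 that survives modulo p.
  residue : ℕ → ℕ → ℤ
  residue K j = sgn r ℤ.^ j ℤ.* + (K C j)

  -- This is a statement about the coefficient `X N K / N !` scaled by `p ^ j`: it vanishes modulo
  -- `p` when `r * j` exceeds `N - K`, and reduces to `residue K j` on equality. Keeping `N !` in
  -- the modulus avoids rational numbers.
  LogPower : ℕ → Set
  LogPower K = ∀ N j →
    (N < K + r * j → + p ℤ.* + (N !) ∣ₗ + (p ^ j) ℤ.* X N K) ×
    (N ≡ K + r * j → + p ℤ.* + (N !) ∣ₗ + (p ^ j) ℤ.* X N K ℤ.- residue K j ℤ.* + (N !))

  X-< : ∀ {m K} → m < K → X m K ≡ + 0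
  X-< {m} {K} m<K = trans (cong (+ (K !) ℤ.*_) (stirling1-< (s≤s m<K))) (ℤₚ.*-zeroʳ (+ (K !)))

  -- The factor `suc K` in `stirling1-log` is absorbed by `suc K !`, so this is the rule log^(K+1) =
  -- log · log^K.
  X-log : ∀ c m K → c ℤ.* X (suc m) (suc K) ≡ diagSum (logTerm (λ i → c ℤ.* X i K)) m 0
  X-log c m K = begin
    c ℤ.* (+ (suc K * K !) ℤ.* s)                 ≡⟨ cong (λ x → c ℤ.* (x ℤ.* s)) (ℤₚ.pos-* (suc K) (K !)) ⟩
    c ℤ.* (+ suc K ℤ.* + (K !) ℤ.* s)             ≡⟨ lem c (+ suc K) (+ (K !)) s ⟩
    c ℤ.* + (K !) ℤ.* (+ suc K ℤ.* s)             ≡⟨ cong (c ℤ.* + (K !) ℤ.*_) (stirling1-log m (suc K)) ⟩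
    c ℤ.* + (K !) ℤ.* diagSum (logTerm σ) m 0     ≡⟨ diagSum-*ˡ (c ℤ.* + (K !)) (logTerm σ) _ m 0 (λ m′ i → lem′ c (+ (K !)) (sgn i) (+ logCoeff m′ i) (σ m′)) ⟩
    diagSum (logTerm (λ i → c ℤ.* X i K)) m 0     ∎
    where
    open ≡-Reasoning
    s : ℤ
    s = stirling1 (2 + m) (2 + K)
    σ : ℕ → ℤ
    σ i = stirling1 (suc i) (suc K)
    lem : ∀ c k f s → c ℤ.* (k ℤ.* f ℤ.* s) ≡ c ℤ.* f ℤ.* (k ℤ.* s)
    lem = ℤ-Solver.solve-∀
    lem′ : ∀ c f g q s → c ℤ.* f ℤ.* (g ℤ.* q ℤ.* s) ≡ g ℤ.* q ℤ.* (c ℤ.* (f ℤ.* s))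
    lem′ = ℤ-Solver.solve-∀

  logCoeff-scale : ∀ m i →
    + logCoeff m i ℤ.* + suc i ℤ.* + (m !) ≡ + (suc (m + i) !)
  logCoeff-scale m i = begin
    + logCoeff m i ℤ.* + suc i ℤ.* + (m !)     ≡⟨ lem (+ logCoeff m i) (+ suc i) (+ (m !)) ⟩
    + logCoeff m i ℤ.* (+ (m !) ℤ.* + suc i)   ≡⟨ cong (+ logCoeff m i ℤ.*_) (ℤₚ.pos-* (m !) (suc i)) ⟨
    + logCoeff m i ℤ.* + (m ! * suc i)         ≡⟨ ℤₚ.pos-* (logCoeff m i) (m ! * suc i) ⟨
    + (logCoeff m i * (m ! * suc i))           ≡⟨ cong +_ (logCoeff-! m i) ⟩
    + (suc (m + i) !)                          ∎
    where
    open ≡-Reasoning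
    lem : ∀ a b c → a ℤ.* b ℤ.* c ≡ a ℤ.* (c ℤ.* b)
    lem = ℤ-Solver.solve-∀

  -- Since `logCoeff m i * suc i` equals `N ! / m !` for `N = suc (m + i)`, multiplying by it
  -- carries a congruence for `m` to one for `N`.
  modulus-scale : ∀ m i →
    + logCoeff m i ℤ.* + suc i ℤ.* (+ p ℤ.* + (m !)) ≡ + p ℤ.* + (suc (m + i) !)
  modulus-scale m i =
    trans (lem (+ logCoeff m i ℤ.* + suc i) (+ p) (+ (m !))) (cong (+ p ℤ.*_) (logCoeff-scale m i))
    where
    lem : ∀ a b c → a ℤ.* (b ℤ.* c) ≡ b ℤ.* (a ℤ.* c)
    lem = ℤ-Solver.solve-∀

  pos-^-+ : ∀ w e → + (p ^ (w + e)) ≡ + (p ^ w) ℤ.* + (p ^ e)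
  pos-^-+ w e = trans (cong +_ (ℕₚ.^-distribˡ-+-* p w e)) (ℤₚ.pos-* (p ^ w) (p ^ e))

  logTerm-0 : ∀ {M} c K m i → m < K → M ∣ₗ logTerm (λ k → c ℤ.* X k K) m i
  logTerm-0 {M} c K m i m<K = subst (M ∣ₗ_) (sym eq) ∣ₗ-0
    where
    coeff : ℤ
    coeff = sgn i ℤ.* + logCoeff m i
    eq : coeff ℤ.* (c ℤ.* X m K) ≡ + 0
    eq = trans (cong (λ x → coeff ℤ.* (c ℤ.* x)) (X-< m<K))
               (trans (cong (coeff ℤ.*_) (ℤₚ.*-zeroʳ c)) (ℤₚ.*-zeroʳ coeff))

  -- With w = v(suc i), the factor 1/(suc i) of the logarithm costs w powers of p; the bound says
  -- that X m K still has one power of p to spare.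
  logTerm-small : ∀ {K} → LogPower K → ∀ {N} m i w t j → suc (m + i) ≡ N →
    suc i ≡ p ^ w * t → p ∤ t → m + r * w < K + r * j →
    + p ℤ.* + (N !) ∣ₗ logTerm (λ k → + (p ^ j) ℤ.* X k K) m i
  logTerm-small {K} law m i w t j refl i-eq p∤t bound with ℕₚ.≤-total w j
  -- The bound now forces `m < K`, so the coefficient is zero outright.
  ... | inj₂ j≤w = logTerm-0 (+ (p ^ j)) K m i
    (ℕₚ.+-cancelʳ-< (r * j) m K (ℕₚ.≤-<-trans (ℕₚ.+-monoʳ-≤ m (ℕₚ.*-monoʳ-≤ r j≤w)) bound))
  -- With `j = w + e`, the law at `e` applies; the multiplier `suc i` restores the missing `p ^ w`,
  -- and its `p`-free part `t` is cancelled in the localisation.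
  ... | inj₁ w≤j with e , refl ← ℕₚ.m≤n⇒∃[o]m+o≡n w≤j =
    subst (_ ∣ₗ_) (sym (ℤₚ.*-assoc (sgn i) (+ logCoeff m i) _))
      (∣ₗ-*ˡ (sgn i) (∣ₗ-unit t p∤t
        (∣ₗ-resp (modulus-scale m i) rhs
          (∣ₗ-mono (+ logCoeff m i ℤ.* + suc i) (proj₁ (law m e) m<)))))
    where
    open ≡-Reasoning
    m< : m < K + r * e
    m< = ℕₚ.+-cancelʳ-< (r * w) m (K + r * e) (ℕₚ.<-≤-trans bound (ℕₚ.≤-reflexive (lem K r w e)))
      where
      lem : ∀ K r w e → K + r * (w + e) ≡ K + r * e + r * w
      lem = ℕ-Solver.solve-∀
    rhs : + logCoeff m i ℤ.* + suc i ℤ.* (+ (p ^ e) ℤ.* X m K)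
        ≡ + t ℤ.* (+ logCoeff m i ℤ.* (+ (p ^ (w + e)) ℤ.* X m K))
    rhs = begin
      + logCoeff m i ℤ.* + suc i ℤ.* (+ (p ^ e) ℤ.* X m K)
        ≡⟨ cong (λ x → + logCoeff m i ℤ.* x ℤ.* (+ (p ^ e) ℤ.* X m K)) (trans (cong +_ i-eq) (ℤₚ.pos-* (p ^ w) t)) ⟩
      + logCoeff m i ℤ.* (+ (p ^ w) ℤ.* + t) ℤ.* (+ (p ^ e) ℤ.* X m K)
        ≡⟨ lem (+ logCoeff m i) (+ (p ^ w)) (+ t) (+ (p ^ e)) (X m K) ⟩
      + t ℤ.* (+ logCoeff m i ℤ.* (+ (p ^ w) ℤ.* + (p ^ e) ℤ.* X m K))
        ≡⟨ cong (λ x → + t ℤ.* (+ logCoeff m i ℤ.* (x ℤ.* X m K))) (pos-^-+ w e) ⟨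
      + t ℤ.* (+ logCoeff m i ℤ.* (+ (p ^ (w + e)) ℤ.* X m K)) ∎
      where
      lem : ∀ q w t e x → q ℤ.* (w ℤ.* t) ℤ.* (e ℤ.* x) ≡ t ℤ.* (q ℤ.* (w ℤ.* e ℤ.* x))
      lem = ℤ-Solver.solve-∀

  -- Applied with w = 0 and w = 1, i.e. to the terms t and t^p/p of the logarithm.
  logTerm-main : ∀ {K} → LogPower K → ∀ {N} m i w e → suc (m + i) ≡ N →
    suc i ≡ p ^ w → m ≡ K + r * e →
    + p ℤ.* + (N !) ∣ₗ logTerm (λ k → + (p ^ (w + e)) ℤ.* X k K) m i ℤ.- sgn i ℤ.* residue K e ℤ.* + (N !)
  logTerm-main {K} law m i w e refl i-eq m-eq =
    ∣ₗ-resp (modulus-scale m i) rhs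
      (∣ₗ-*ˡ (sgn i) (∣ₗ-mono (+ logCoeff m i ℤ.* + suc i) (proj₂ (law m e) m-eq)))
    where
    open ≡-Reasoning
    rhs : sgn i ℤ.* (+ logCoeff m i ℤ.* + suc i ℤ.* (+ (p ^ e) ℤ.* X m K ℤ.- residue K e ℤ.* + (m !)))
        ≡ logTerm (λ k → + (p ^ (w + e)) ℤ.* X k K) m i ℤ.- sgn i ℤ.* residue K e ℤ.* + (suc (m + i) !)
    rhs = begin
      sgn i ℤ.* (+ logCoeff m i ℤ.* + suc i ℤ.* (+ (p ^ e) ℤ.* X m K ℤ.- residue K e ℤ.* + (m !)))
        ≡⟨ lem (sgn i) (+ logCoeff m i) (+ suc i) (+ (p ^ e)) (X m K) (residue K e) (+ (m !)) ⟩
      sgn i ℤ.* + logCoeff m i ℤ.* (+ suc i ℤ.* + (p ^ e) ℤ.* X m K)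
        ℤ.- sgn i ℤ.* residue K e ℤ.* (+ logCoeff m i ℤ.* + suc i ℤ.* + (m !))
        ≡⟨ cong₂ (λ x y → sgn i ℤ.* + logCoeff m i ℤ.* (x ℤ.* X m K) ℤ.- sgn i ℤ.* residue K e ℤ.* y)
             (trans (cong (λ x → + x ℤ.* + (p ^ e)) i-eq) (sym (pos-^-+ w e))) (logCoeff-scale m i) ⟩
      logTerm (λ k → + (p ^ (w + e)) ℤ.* X k K) m i ℤ.- sgn i ℤ.* residue K e ℤ.* + (suc (m + i) !) ∎
      where
      lem : ∀ s q i e x c f → s ℤ.* (q ℤ.* i ℤ.* (e ℤ.* x ℤ.- c ℤ.* f))
          ≡ s ℤ.* q ℤ.* (i ℤ.* e ℤ.* x) ℤ.- s ℤ.* c ℤ.* (q ℤ.* i ℤ.* f)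
      lem = ℤ-Solver.solve-∀

  -- Bounds on the valuation of the denominators `suc i`.

  bernoulli : ∀ w → r * w < p ^ w
  bernoulli zero    = ℕₚ.≤-reflexive (cong suc (ℕₚ.*-zeroʳ r))
  bernoulli (suc w) = begin-strict
    r * suc w            ≡⟨ ℕₚ.*-suc r w ⟩
    r + r * w            <⟨ ℕₚ.+-monoʳ-< r (bernoulli w) ⟩
    r + p ^ w            ≤⟨ ℕₚ.+-monoˡ-≤ (p ^ w) (ℕₚ.m≤m*n r (p ^ w) {{ℕₚ.m^n≢0 p w}}) ⟩
    r * p ^ w + p ^ w    ≡⟨ ℕₚ.+-comm (r * p ^ w) (p ^ w) ⟩
    p ^ suc w            ∎
    where open ℕₚ.≤-Reasoning

  -- For exponents at least 2 the Bernoulli bound has room to spare, which rules out equality in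
  -- `valuation≤` there.
  bernoulli-strict : ∀ w → suc (r * (2 + w)) < p ^ (2 + w)
  bernoulli-strict w = begin-strict
    suc (r * (2 + w))          ≡⟨ lem r w ⟩
    suc r + r * suc w          <⟨ ℕₚ.+-monoʳ-< (suc r) (bernoulli (suc w)) ⟩
    suc r + q                  ≡⟨ ℕₚ.+-comm (suc r) q ⟩
    q + suc r                  ≤⟨ ℕₚ.+-monoʳ-≤ q suc-r≤ ⟩
    q + r * q                  ∎
    where
    open ℕₚ.≤-Reasoning
    q : ℕ
    q = p ^ suc w
    lem : ∀ r w → suc (r * (2 + w)) ≡ suc r + r * suc w
    lem = ℕ-Solver.solve-∀
    suc-r≤ : suc r ≤ r * q
    suc-r≤ = ℕₚ.≤-trans (ℕₚ.m≤m*n p (p ^ w) {{ℕₚ.m^n≢0 p w}})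
                        (ℕₚ.m≤n*m q r {{>-nonZero 0<r}})

  nonZero-∤ : ∀ {t} → p ∤ t → NonZero t
  nonZero-∤ {zero}  p∤0 = contradiction (p ℕ∣.∣0) p∤0
  nonZero-∤ {suc t} _   = _

  valuation≤ : ∀ {i} w t → suc i ≡ p ^ w * t → p ∤ t → r * w ≤ i
  valuation≤ {i} w t eq p∤t = ℕₚ.≤-pred (begin
    suc (r * w)   ≤⟨ bernoulli w ⟩
    p ^ w         ≤⟨ ℕₚ.m≤m*n (p ^ w) t {{nonZero-∤ p∤t}} ⟩
    p ^ w * t     ≡⟨ eq ⟨
    suc i         ∎)
    where open ℕₚ.≤-Reasoning

  -- Equality in `valuation≤` would mean `i = 0` for `w = 0` and `i = r` for `w = 1`; larger `w` are
  -- excluded by `bernoulli-strict`.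
  valuation< : ∀ {i} w t → suc i ≡ p ^ w * t → p ∤ t → i ≢ 0 → i ≢ r → r * w < i
  valuation< {i} 0 t eq p∤t i≢0 i≢r = subst (_< i) (sym (ℕₚ.*-zeroʳ r)) (ℕₚ.n≢0⇒n>0 i≢0)
  valuation< {i} 1 t eq p∤t i≢0 i≢r =
    ℕₚ.≤∧≢⇒< (valuation≤ 1 t eq p∤t) λ e → i≢r (sym (trans (sym (ℕₚ.*-identityʳ r)) e))
  valuation< {i} (suc (suc w)) t eq p∤t i≢0 i≢r = ℕₚ.≤-pred (begin-strict
    suc (r * (2 + w))   <⟨ bernoulli-strict w ⟩
    p ^ (2 + w)         ≤⟨ ℕₚ.m≤m*n (p ^ (2 + w)) t {{nonZero-∤ p∤t}} ⟩
    p ^ (2 + w) * t     ≡⟨ eq ⟨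
    suc i               ∎)
    where open ℕₚ.≤-Reasoning

  -- Induction on the power of the logarithm.

  -- The coefficients of 1/(1+t) are ±1, so a single factor `p` already gives the vanishing; only
  -- `N = j = 0` leaves a nonzero residue.
  logPower-0 : LogPower 0
  logPower-0 N j = small j , exact j
    where
    open ≡-Reasoning
    multiple : ∀ j → + p ℤ.* + (N !) ∣ₗ + (p ^ suc j) ℤ.* X N 0
    multiple j = subst (_ ∣ₗ_)
      (begin
        + (p ^ j) ℤ.* sgn N ℤ.* (+ p ℤ.* + (N !))           ≡⟨ lem (+ (p ^ j)) (sgn N) (+ p) (+ (N !)) ⟩
        + p ℤ.* + (p ^ j) ℤ.* (+ 1 ℤ.* (sgn N ℤ.* + (N !)))
          ≡⟨ cong₂ (λ x y → x ℤ.* (+ 1 ℤ.* y)) (sym (ℤₚ.pos-* p (p ^ j))) (sym (stirling1-1 N)) ⟩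
        + (p ^ suc j) ℤ.* X N 0                             ∎)
      (∣ₗ-multiple (+ p ℤ.* + (N !)) (+ (p ^ j) ℤ.* sgn N))
      where
      lem : ∀ a b c d → a ℤ.* b ℤ.* (c ℤ.* d) ≡ c ℤ.* a ℤ.* (+ 1 ℤ.* (b ℤ.* d))
      lem = ℤ-Solver.solve-∀
    small : ∀ j → N < r * j → + p ℤ.* + (N !) ∣ₗ + (p ^ j) ℤ.* X N 0
    small zero    N< = contradiction (subst (N <_) (ℕₚ.*-zeroʳ r) N<) λ ()
    small (suc j) _  = multiple j
    exact : ∀ j → N ≡ r * j → + p ℤ.* + (N !) ∣ₗ + (p ^ j) ℤ.* X N 0 ℤ.- residue 0 j ℤ.* + (N !)
    exact zero    N≡ with refl ← trans N≡ (ℕₚ.*-zeroʳ r) = ∣ₗ-0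
    exact (suc j) _  = subst (_ ∣ₗ_) (sym (trans (cong (λ x → + (p ^ suc j) ℤ.* X N 0 ℤ.- x ℤ.* + (N !)) vanish) (ℤₚ.+-identityʳ _))) (multiple j)
      where
      vanish : residue 0 (suc j) ≡ + 0
      vanish = ℤₚ.*-zeroʳ (sgn r ℤ.^ suc j)

  -- Expand by `X-log`. When `N` is exactly on the lattice, the terms `i = 0` and `i = r` contribute
  -- `residue K j` and `sgn r` times `residue K (j - 1)`, and Pascal's rule adds them; all other
  -- terms vanish modulo `p`.
  logPower-suc : ∀ {K} → LogPower K → LogPower (suc K)
  logPower-suc {K} law zero    j =
    (λ _ → subst (_ ∣ₗ_) (sym (trans (cong (+ (p ^ j) ℤ.*_) (X-< {0} {suc K} (s≤s z≤n))) (ℤₚ.*-zeroʳ (+ (p ^ j))))) ∣ₗ-0) ,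
    λ ()
  logPower-suc {K} law (suc m) j =
    (λ m< → subst (M ∣ₗ_) (sym (X-log (+ (p ^ j)) m K)) (∣ₗ-diagSum _ m 0 (small (ℕₚ.≤-pred m<)))) ,
    λ m≡ → subst (λ x → M ∣ₗ x ℤ.- residue (suc K) j ℤ.* + (suc m !)) (sym (X-log (+ (p ^ j)) m K)) (exact m j refl (ℕₚ.suc-injective m≡))
    where
    open ≡-Reasoning
    M : ℤ
    M = + p ℤ.* + (suc m !)
    index : ∀ m′ i → m′ + i ≡ m + 0 → m′ + i ≡ m
    index m′ i eq = trans eq (ℕₚ.+-identityʳ m)
    small : m < K + r * j → ∀ m′ i → m′ + i ≡ m + 0 → 0 ≤ i →
      M ∣ₗ logTerm (λ k → + (p ^ j) ℤ.* X k K) m′ i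
    small m< m′ i eq _ with w , t , i-eq , p∤t , _ ← valuation-suc i =
      logTerm-small law m′ i w t j (cong suc (index m′ i eq)) i-eq p∤t
        (ℕₚ.≤-<-trans (ℕₚ.+-monoʳ-≤ m′ (valuation≤ w t i-eq p∤t)) (subst (_< K + r * j) (sym (index m′ i eq)) m<))
    exact : ∀ m′ j → m′ ≡ m → m ≡ K + r * j →
      M ∣ₗ diagSum (logTerm (λ k → + (p ^ j) ℤ.* X k K)) m′ 0 ℤ.- residue (suc K) j ℤ.* + (suc m !)
    -- Here `m = K`, so every `i > 0` leaves `m′ < K`, where `X` vanishes; only `i = 0` contributes.
    exact m₁ zero refl m≡ =
      subst (M ∣ₗ_) (lem (diagSum f m 0) (f m 0) (+ (suc m !)))
        (∣ₗ-+ (∣ₗ-diagSum-except f m 0 m 0 z≤n refl others)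
              (logTerm-main law m 0 0 0 (cong suc (ℕₚ.+-identityʳ m)) refl m≡))
      where
      f : ℕ → ℕ → ℤ
      f = logTerm (λ k → + 1 ℤ.* X k K)
      lem : ∀ d x n → (d ℤ.- x) ℤ.+ (x ℤ.- + 1 ℤ.* + 1 ℤ.* n) ≡ d ℤ.- + 1 ℤ.* n
      lem = ℤ-Solver.solve-∀
      m≡K : m ≡ K
      m≡K = trans m≡ (trans (cong (λ x → K + x) (ℕₚ.*-zeroʳ r)) (ℕₚ.+-identityʳ K))
      others : ∀ m′ i → m′ + i ≡ m + 0 → 0 ≤ i → i ≢ 0 → M ∣ₗ f m′ i
      others m′ i eq _ i≢0 = logTerm-0 (+ 1) K m′ i
        (subst (m′ <_) (trans (index m′ i eq) m≡K) (ℕₚ.m<m+n m′ (ℕₚ.n≢0⇒n>0 i≢0)))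
    exact zero     (suc e) refl m≡ = contradiction m≡
      (ℕₚ.<⇒≢ (ℕₚ.<-≤-trans (ℕₚ.<-≤-trans 0<r (ℕₚ.m≤m*n r (suc e))) (ℕₚ.m≤n+m (r * suc e) K)))
    -- The term `i = 0` is compared through `law` at `suc e`. The term `i = r` has `suc i = p`,
    -- which uses up one power of `p`, so it takes `law` at `e`.
    exact (suc m₁) (suc e) refl m≡ =
      subst (M ∣ₗ_) total
        (∣ₗ-+ (logTerm-main law (suc m₁) 0 0 (suc e) (cong suc (ℕₚ.+-identityʳ (suc m₁))) refl m≡)
          (∣ₗ-+ (∣ₗ-diagSum-except f m₁ 1 (K + r * e) r 0<r m₀-eq others)
                (logTerm-main law (K + r * e) r 1 e (cong suc (trans m₀-eq (ℕₚ.+-comm m₁ 1))) (sym (ℕₚ.*-identityʳ p)) refl)))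
      where
      f : ℕ → ℕ → ℤ
      f = logTerm (λ k → + (p ^ suc e) ℤ.* X k K)
      m₀-eq : K + r * e + r ≡ m₁ + 1
      m₀-eq = trans (lem K r e) (trans (sym m≡) (ℕₚ.+-comm 1 m₁))
        where
        lem : ∀ K r e → K + r * e + r ≡ K + r * suc e
        lem = ℕ-Solver.solve-∀
      others : ∀ m′ i → m′ + i ≡ m₁ + 1 → 1 ≤ i → i ≢ r → M ∣ₗ f m′ i
      others m′ i eq 1≤i i≢r with w , t , i-eq , p∤t , _ ← valuation-suc i =
        logTerm-small law m′ i w t (suc e) (cong suc m′+i≡) i-eq p∤t
          (ℕₚ.<-≤-trans (ℕₚ.+-monoʳ-< m′ (valuation< w t i-eq p∤t (ℕₚ.m<n⇒n≢0 1≤i) i≢r))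
            (ℕₚ.≤-reflexive (trans m′+i≡ m≡)))
        where
        m′+i≡ : m′ + i ≡ suc m₁
        m′+i≡ = trans eq (ℕₚ.+-comm m₁ 1)
      pascal : residue (suc K) (suc e) ≡ sgn 0 ℤ.* residue K (suc e) ℤ.+ sgn r ℤ.* residue K e
      pascal = trans
        (cong (λ x → sgn r ℤ.^ suc e ℤ.* x)
          (pos-split (K C e) (K C suc e) (sym (nCk+nC[k+1]≡[n+1]C[k+1] K e))))
        (lem (sgn r) (sgn r ℤ.^ e) (+ (K C e)) (+ (K C suc e)))
        where
        lem : ∀ s t x y → s ℤ.* t ℤ.* (x ℤ.+ y) ≡ + 1 ℤ.* (s ℤ.* t ℤ.* y) ℤ.+ s ℤ.* (t ℤ.* x)
        lem = ℤ-Solver.solve-∀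
      head : ℤ
      head = f (suc m₁) 0
      total : (head ℤ.- sgn 0 ℤ.* residue K (suc e) ℤ.* + (suc m !))
          ℤ.+ ((diagSum f m₁ 1 ℤ.- f (K + r * e) r) ℤ.+ (f (K + r * e) r ℤ.- sgn r ℤ.* residue K e ℤ.* + (suc m !)))
        ≡ (head ℤ.+ diagSum f m₁ 1) ℤ.- residue (suc K) (suc e) ℤ.* + (suc m !)
      total = trans
        (lem head (sgn 0 ℤ.* residue K (suc e)) (+ (suc m !)) (diagSum f m₁ 1) (f (K + r * e) r) (sgn r ℤ.* residue K e))
        (cong (λ x → (head ℤ.+ diagSum f m₁ 1) ℤ.- x ℤ.* + (suc m !)) (sym pascal))
        where
        lem : ∀ h a n d g b → (h ℤ.- a ℤ.* n) ℤ.+ ((d ℤ.- g) ℤ.+ (g ℤ.- b ℤ.* n))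
            ≡ (h ℤ.+ d) ℤ.- (a ℤ.+ b) ℤ.* n
        lem = ℤ-Solver.solve-∀

  logPower : ∀ K → LogPower K
  logPower zero    = logPower-0
  logPower (suc K) = logPower-suc (logPower K)

  -- Binomial coefficients prime to `p`.

  -- If `w < h`, the cofactors of `p ^ w` sum to a multiple of `p`, so neither is divisible by `p`.
  -- If `w = h`, they sum to `a < p`, so `t′` lies strictly between 0 and `p`. If `w > h`, then `x`
  -- alone is at least `a * p ^ h`.
  complement-valuation : ∀ {a h x y} w t → 0 < y → a < p → x + y ≡ a * p ^ h → x ≡ p ^ w * t → p ∤ t →
    ∃ λ t′ → y ≡ p ^ w * t′ × p ∤ t′
  complement-valuation {a} {h} {x} {y} w t 0<y a<p sum-eq x-eq p∤t with ℕₚ.<-≤-connex w h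
  ... | inj₁ w<h with e , refl ← ℕₚ.m≤n⇒∃[o]m+o≡n w<h = t′ , y-eq , p∤t′
    where
    open ≡-Reasoning
    sum-eq′ : p ^ w * t + y ≡ p ^ w * (a * p ^ e * p)
    sum-eq′ = begin
      p ^ w * t + y                ≡⟨ cong (_+ y) x-eq ⟨
      x + y                        ≡⟨ sum-eq ⟩
      a * (p * p ^ (w + e))        ≡⟨ cong (λ q → a * (p * q)) (ℕₚ.^-distribˡ-+-* p w e) ⟩
      a * (p * (p ^ w * p ^ e))    ≡⟨ lem a p (p ^ w) (p ^ e) ⟩
      p ^ w * (a * p ^ e * p)      ∎
      where
      lem : ∀ a p w e → a * (p * (w * e)) ≡ w * (a * e * p)
      lem = ℕ-Solver.solve-∀
    p^w∣y : p ^ w ∣ y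
    p^w∣y = ℕ∣.∣m+n∣m⇒∣n (subst (p ^ w ∣_) (sym sum-eq′) (m∣m*n (a * p ^ e * p))) (m∣m*n t)
    t′ : ℕ
    t′ = ℕ∣.quotient p^w∣y
    y-eq : y ≡ p ^ w * t′
    y-eq = ℕ∣.m∣n⇒n≡m*quotient p^w∣y
    t+t′ : t + t′ ≡ a * p ^ e * p
    t+t′ = ℕₚ.*-cancelˡ-≡ (t + t′) (a * p ^ e * p) (p ^ w) {{ℕₚ.m^n≢0 p w}}
      (trans (ℕₚ.*-distribˡ-+ (p ^ w) t t′) (trans (cong (λ q → p ^ w * t + q) (sym y-eq)) sum-eq′))
    p∤t′ : p ∤ t′
    p∤t′ p∣t′ = p∤t (ℕ∣.∣m+n∣m⇒∣n (subst (p ∣_) (trans (sym t+t′) (ℕₚ.+-comm t t′)) (divides (a * p ^ e) refl)) p∣t′)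
  ... | inj₂ h≤w with ℕₚ.m≤n⇒∃[o]m+o≡n h≤w
  ... | zero , refl = t′ , trans y-eq (cong (λ q → p ^ q * t′) (sym (ℕₚ.+-identityʳ h))) , p∤t′
    where
    sum-eq′ : p ^ h * t + y ≡ p ^ h * a
    sum-eq′ = trans (cong (_+ y) (trans (cong (λ q → p ^ q * t) (sym (ℕₚ.+-identityʳ h))) (sym x-eq)))
                    (trans sum-eq (ℕₚ.*-comm a (p ^ h)))
    p^h∣y : p ^ h ∣ y
    p^h∣y = ℕ∣.∣m+n∣m⇒∣n (subst (p ^ h ∣_) (sym sum-eq′) (m∣m*n a)) (m∣m*n t)
    t′ : ℕ
    t′ = ℕ∣.quotient p^h∣y
    y-eq : y ≡ p ^ h * t′
    y-eq = ℕ∣.m∣n⇒n≡m*quotient p^h∣y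
    t+t′ : t + t′ ≡ a
    t+t′ = ℕₚ.*-cancelˡ-≡ (t + t′) a (p ^ h) {{ℕₚ.m^n≢0 p h}}
      (trans (ℕₚ.*-distribˡ-+ (p ^ h) t t′) (trans (cong (λ q → p ^ h * t + q) (sym y-eq)) sum-eq′))
    p∤t′ : p ∤ t′
    p∤t′ p∣t′ = ℕₚ.<⇒≱ (ℕₚ.≤-<-trans (ℕₚ.≤-trans (ℕₚ.m≤n+m t′ t) (ℕₚ.≤-reflexive t+t′)) a<p)
      (∣⇒≤ {{ℕ∣.quotient≢0 p^h∣y {{>-nonZero 0<y}}}} p∣t′)
  ... | suc e , refl = contradiction x+y≤x (ℕₚ.<⇒≱ (ℕₚ.m<m+n x 0<y))
    where
    open ℕₚ.≤-Reasoning
    x+y≤x : x + y ≤ x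
    x+y≤x = begin
      x + y                      ≡⟨ sum-eq ⟩
      a * p ^ h                  ≤⟨ ℕₚ.*-monoˡ-≤ (p ^ h) (ℕₚ.<⇒≤ a<p) ⟩
      p ^ suc h                  ≤⟨ ℕₚ.^-monoʳ-≤ p (ℕₚ.≤-trans (s≤s (ℕₚ.m≤m+n h e)) (ℕₚ.≤-reflexive (sym (ℕₚ.+-suc h e)))) ⟩
      p ^ (h + suc e)            ≤⟨ ℕₚ.m≤m*n (p ^ (h + suc e)) t {{nonZero-∤ p∤t}} ⟩
      p ^ (h + suc e) * t        ≡⟨ x-eq ⟨
      x                          ∎

  -- Gives the ratio of consecutive binomial coefficients; the upper entry is written `j + d` to
  -- avoid subtraction.
  choose-absorb : ∀ j d → suc j * ((j + d) C suc j) ≡ d * ((j + d) C j)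
  choose-absorb zero    d = trans (ℕₚ.+-identityʳ (d C 1)) (trans (nC1≡n d) (sym (ℕₚ.*-identityʳ d)))
  choose-absorb (suc j) zero = trans (cong (λ q → suc (suc j) * q) (k>n⇒nCk≡0 (s≤s (s≤s (ℕₚ.≤-reflexive (ℕₚ.+-identityʳ j))))))
    (ℕₚ.*-zeroʳ (suc (suc j)))
  choose-absorb (suc j) (suc d) = begin
    (2 + j) * (suc n C (2 + j))                      ≡⟨ cong (λ q → (2 + j) * q) (nCk+nC[k+1]≡[n+1]C[k+1] n (suc j)) ⟨
    (2 + j) * (n C suc j + n C (2 + j))              ≡⟨ lem j (n C suc j) (n C (2 + j)) ⟩
    suc j * (n C suc j) + (n C suc j + (2 + j) * (n C (2 + j)))
      ≡⟨ cong₂ (λ x y → x + (n C suc j + y)) (choose-absorb j (suc d)) shifted ⟩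
    suc d * (n C j) + (n C suc j + d * (n C suc j))  ≡⟨ lem′ d (n C j) (n C suc j) ⟩
    suc d * (n C j + n C suc j)                      ≡⟨ cong (λ q → suc d * q) (nCk+nC[k+1]≡[n+1]C[k+1] n j) ⟩
    suc d * (suc n C suc j)                          ∎
    where
    open ≡-Reasoning
    n : ℕ
    n = j + suc d
    shifted : (2 + j) * (n C (2 + j)) ≡ d * (n C suc j)
    shifted = subst (λ q → (2 + j) * (q C (2 + j)) ≡ d * (q C suc j)) (sym (ℕₚ.+-suc j d)) (choose-absorb (suc j) d)
    lem : ∀ j x y → (2 + j) * (x + y) ≡ suc j * x + (x + (2 + j) * y)
    lem = ℕ-Solver.solve-∀
    lem′ : ∀ d x y → suc d * x + (y + d * y) ≡ suc d * (x + y)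
    lem′ = ℕ-Solver.solve-∀

  -- The ratio of `K C suc j` to `K C j` is `(K - j) / (j + 1)`. Its two parts sum to `a * p ^ h`,
  -- hence have equal valuation by `complement-valuation`, and the ratio is a unit at `p`.
  p∤choose : ∀ {a h K} → a < p → suc K ≡ a * p ^ h → ∀ j → j ≤ K → p ∤ K C j
  p∤choose a<p K-eq zero    _ = p∤1
  p∤choose {a} {h} a<p K-eq (suc j) j<K p∣C
    with d , refl ← ℕₚ.m≤n⇒∃[o]m+o≡n j<K
    with w , t , j-eq , p∤t , _ ← valuation-suc j
    with t′ , d-eq , p∤t′ ← complement-valuation {a} {h} w t (s≤s z≤n) a<p
           (trans (cong suc (ℕₚ.+-suc j d)) K-eq) j-eq p∤t =
    p∤* p∤t′ (p∤choose {a} {h} a<p K-eq j (ℕₚ.<⇒≤ j<K)) (subst (p ∣_) units (ℕ∣.∣n⇒∣m*n t p∣C))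
    where
    open ≡-Reasoning
    K : ℕ
    K = suc j + d
    units : t * (K C suc j) ≡ t′ * (K C j)
    units = ℕₚ.*-cancelˡ-≡ _ _ (p ^ w) {{ℕₚ.m^n≢0 p w}} (begin
      p ^ w * (t * (K C suc j))   ≡⟨ ℕₚ.*-assoc (p ^ w) t _ ⟨
      p ^ w * t * (K C suc j)     ≡⟨ cong (_* (K C suc j)) j-eq ⟨
      suc j * (K C suc j)         ≡⟨ subst (λ q → suc j * (q C suc j) ≡ suc d * (q C j)) (ℕₚ.+-suc j d) (choose-absorb j (suc d)) ⟩
      suc d * (K C j)             ≡⟨ cong (_* (K C j)) d-eq ⟩
      p ^ w * t′ * (K C j)        ≡⟨ ℕₚ.*-assoc (p ^ w) t′ _ ⟩
      p ^ w * (t′ * (K C j))      ∎)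

  -- From the congruence to the valuation.

  p^-∣-cancel : ∀ v {t x} → p ∤ t → p ^ v ∣ t * x → p ^ v ∣ x
  p^-∣-cancel zero    {t} {x} p∤t _ = ℕ∣.1∣ x
  p^-∣-cancel (suc v) {t} {x} p∤t p^∣ with euclidsLemma t x p-prime (ℕ∣.m*n∣⇒m∣ p (p ^ v) p^∣)
  ... | inj₁ p∣t = contradiction p∣t p∤t
  ... | inj₂ (divides x′ refl) = subst (p ^ suc v ∣_) (ℕₚ.*-comm p x′)
    (ℕ∣.*-monoʳ-∣ p (p^-∣-cancel v p∤t (ℕ∣.*-cancelˡ-∣ p (subst (p ^ suc v ∣_) (lem t x′ p) p^∣))))
    where
    lem : ∀ t x p → t * (x * p) ≡ p * (t * x)
    lem = ℕ-Solver.solve-∀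

  -- As `t` and `y` are prime to `p`, the valuation of `x` must be `B - A`; if `B < A`, a factor `p`
  -- would be left over in `y`.
  valuation-from-units : ∀ A B {t x y} → p ∤ t → p ∤ y → p ^ A * (t * x) ≡ p ^ B * y →
    ∃ λ v → A + v ≡ B × p ^ v ∣ x × p ^ suc v ∤ x
  valuation-from-units A B {t} {x} {y} p∤t p∤y eq with ℕₚ.<-≤-connex B A
  ... | inj₁ B<A with e , refl ← ℕₚ.m≤n⇒∃[o]m+o≡n B<A =
    contradiction (divides (p ^ e * (t * x)) y-eq) p∤y
    where
    open ≡-Reasoning
    y-eq : y ≡ p ^ e * (t * x) * p
    y-eq = ℕₚ.*-cancelˡ-≡ _ _ (p ^ B) {{ℕₚ.m^n≢0 p B}} (begin
      p ^ B * y                        ≡⟨ eq ⟨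
      p * p ^ (B + e) * (t * x)        ≡⟨ cong (λ q → p * q * (t * x)) (ℕₚ.^-distribˡ-+-* p B e) ⟩
      p * (p ^ B * p ^ e) * (t * x)    ≡⟨ lem p (p ^ B) (p ^ e) (t * x) ⟩
      p ^ B * (p ^ e * (t * x) * p)    ∎)
      where
      lem : ∀ p b e x → p * (b * e) * x ≡ b * (e * x * p)
      lem = ℕ-Solver.solve-∀
  ... | inj₂ A≤B with v , refl ← ℕₚ.m≤n⇒∃[o]m+o≡n A≤B =
    v , refl , p^-∣-cancel v p∤t (divides y (trans tx-eq (ℕₚ.*-comm (p ^ v) y))) , p^suc∤
    where
    open ≡-Reasoning
    tx-eq : t * x ≡ p ^ v * y
    tx-eq = ℕₚ.*-cancelˡ-≡ _ _ (p ^ A) {{ℕₚ.m^n≢0 p A}} (begin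
      p ^ A * (t * x)          ≡⟨ eq ⟩
      p ^ (A + v) * y          ≡⟨ cong (_* y) (ℕₚ.^-distribˡ-+-* p A v) ⟩
      p ^ A * p ^ v * y        ≡⟨ ℕₚ.*-assoc (p ^ A) (p ^ v) y ⟩
      p ^ A * (p ^ v * y)      ∎)
    p^suc∤ : p ^ suc v ∤ x
    p^suc∤ p^∣x = p∤y (ℕ∣.*-cancelˡ-∣ (p ^ v) {{ℕₚ.m^n≢0 p v}}
      (ℕ∣.∣-trans (ℕ∣.∣-reflexive (ℕₚ.*-comm (p ^ v) p)) (subst (p ^ suc v ∣_) tx-eq (ℕ∣.∣n⇒∣m*n t p^∣x))))

  ∣sgn^∣ : ∀ i j → ℤ.∣ sgn i ℤ.^ j ∣ ≡ 1
  ∣sgn^∣ i zero    = refl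
  ∣sgn^∣ i (suc j) = trans (ℤₚ.abs-* (sgn i) (sgn i ℤ.^ j)) (cong₂ _*_ (∣sgn∣ i) (∣sgn^∣ i j))
    where
    ∣sgn∣ : ∀ i → ℤ.∣ sgn i ∣ ≡ 1
    ∣sgn∣ zero    = refl
    ∣sgn∣ (suc i) = trans (ℤₚ.∣-i∣≡∣i∣ (sgn i)) (∣sgn∣ i)

  ∣residue∣ : ∀ K j → ℤ.∣ residue K j ∣ ≡ K C j
  ∣residue∣ K j = trans (ℤₚ.abs-* (sgn r ℤ.^ j) (+ (K C j)))
    (trans (cong (_* (K C j)) (∣sgn^∣ r j)) (ℕₚ.*-identityˡ (K C j)))

  -- Modulo `p`, the number `p ^ j * K ! * s / N !` is `± K C j`, a unit. So v(s) = v(N!) - v(K!) -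
  -- j, which Legendre's formula expresses by digit sums.
  stirling1-valuation : ∀ K j → p ∤ K C j →
    Σ ℕ λ v → IsPAdicVal p (stirling1 (suc (K + r * j)) (suc K)) v ×
      v * r + digitSum p (K + r * j) ≡ digitSum p K
  stirling1-valuation K j p∤C =
    conclude (proj₂ (logPower K N j) refl) (legendre N) (legendre K)
    where
    open ≡-Reasoning
    N : ℕ
    N = K + r * j
    s : ℤ
    s = stirling1 (suc N) (suc K)
    lem : ∀ v r d q → v * r + d + r * q ≡ d + r * (q + v)
    lem = ℕ-Solver.solve-∀
    lem′ : ∀ d r a j → d + r * a + r * j ≡ d + r * (j + a)
    lem′ = ℕ-Solver.solve-∀
    -- The cofactor of `p ^ vN` after clearing denominators: `u` is the denominator of the localised
    -- congruence, `z` its quotient and `uN` the `p`-free part of `N !`.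
    y : ℕ → ℤ → ℕ → ℤ
    y u z uN = + uN ℤ.* (+ u ℤ.* residue K j ℤ.+ z ℤ.* + p)
    p∤y : ∀ {u z uN} → p ∤ u → p ∤ uN → p ∤ ℤ.∣ y u z uN ∣
    p∤y {u} {z} {uN} p∤u p∤uN = subst (p ∤_) (sym (ℤₚ.abs-* (+ uN) _)) (p∤* p∤uN λ p∣ →
      p∤* p∤u p∤C (subst (p ∣_) (trans (ℤₚ.abs-* (+ u) (residue K j)) (cong (λ q → u * q) (∣residue∣ K j)))
        (ℤ∣.∣⇒∣ᵤ (ℤ∣.∣m+n∣n⇒∣m {+ p} {+ u ℤ.* residue K j} (ℤ∣.∣ᵤ⇒∣ {+ p} {+ u ℤ.* residue K j ℤ.+ z ℤ.* + p} p∣) (ℤ∣.divides z refl)))))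
    balance : ∀ u z → + u ℤ.* (+ (p ^ j) ℤ.* X N K ℤ.- residue K j ℤ.* + (N !)) ≡ z ℤ.* (+ p ℤ.* + (N !)) →
      ∀ vN uN → N ! ≡ p ^ vN * uN → ∀ vK uK → K ! ≡ p ^ vK * uK →
      p ^ (j + vK) * (u * uK * ℤ.∣ s ∣) ≡ p ^ vN * ℤ.∣ y u z uN ∣
    balance u z law vN uN N!-eq vK uK K!-eq = begin
      p ^ (j + vK) * (u * uK * ℤ.∣ s ∣)           ≡⟨ cong (λ q → p ^ (j + vK) * q) (ℤₚ.abs-* (+ (u * uK)) s) ⟨
      p ^ (j + vK) * ℤ.∣ + (u * uK) ℤ.* s ∣       ≡⟨ ℤₚ.abs-* (+ (p ^ (j + vK))) (+ (u * uK) ℤ.* s) ⟨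
      ℤ.∣ + (p ^ (j + vK)) ℤ.* (+ (u * uK) ℤ.* s) ∣   ≡⟨ cong ℤ.∣_∣ signed ⟩
      ℤ.∣ + (p ^ vN) ℤ.* y u z uN ∣               ≡⟨ ℤₚ.abs-* (+ (p ^ vN)) (y u z uN) ⟩
      p ^ vN * ℤ.∣ y u z uN ∣                     ∎
      where
      split : ∀ {n} v t → n ≡ p ^ v * t → + n ≡ + (p ^ v) ℤ.* + t
      split v t eq = trans (cong +_ eq) (ℤₚ.pos-* (p ^ v) t)
      signed : + (p ^ (j + vK)) ℤ.* (+ (u * uK) ℤ.* s) ≡ + (p ^ vN) ℤ.* y u z uN
      signed = begin
        + (p ^ (j + vK)) ℤ.* (+ (u * uK) ℤ.* s)
          ≡⟨ cong₂ (λ a b → a ℤ.* (b ℤ.* s)) (pos-^-+ j vK) (ℤₚ.pos-* u uK) ⟩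
        + (p ^ j) ℤ.* + (p ^ vK) ℤ.* (+ u ℤ.* + uK ℤ.* s)
          ≡⟨ lem₁ (+ (p ^ j)) (+ (p ^ vK)) (+ u) (+ uK) s ⟩
        + u ℤ.* (+ (p ^ j) ℤ.* (+ (p ^ vK) ℤ.* + uK ℤ.* s))
          ≡⟨ cong (λ a → + u ℤ.* (+ (p ^ j) ℤ.* (a ℤ.* s))) (split vK uK K!-eq) ⟨
        + u ℤ.* (+ (p ^ j) ℤ.* X N K)
          ≡⟨ lem₂ (+ u) (+ (p ^ j) ℤ.* X N K) (residue K j) (+ (N !)) ⟩
        + u ℤ.* (+ (p ^ j) ℤ.* X N K ℤ.- residue K j ℤ.* + (N !)) ℤ.+ + u ℤ.* residue K j ℤ.* + (N !)
          ≡⟨ cong (ℤ._+ + u ℤ.* residue K j ℤ.* + (N !)) law ⟩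
        z ℤ.* (+ p ℤ.* + (N !)) ℤ.+ + u ℤ.* residue K j ℤ.* + (N !)
          ≡⟨ cong (λ a → z ℤ.* (+ p ℤ.* a) ℤ.+ + u ℤ.* residue K j ℤ.* a) (split vN uN N!-eq) ⟩
        z ℤ.* (+ p ℤ.* (+ (p ^ vN) ℤ.* + uN)) ℤ.+ + u ℤ.* residue K j ℤ.* (+ (p ^ vN) ℤ.* + uN)
          ≡⟨ lem₃ z (+ p) (+ (p ^ vN)) (+ uN) (+ u) (residue K j) ⟩
        + (p ^ vN) ℤ.* y u z uN ∎
        where
        lem₁ : ∀ a b u k s → a ℤ.* b ℤ.* (u ℤ.* k ℤ.* s) ≡ u ℤ.* (a ℤ.* (b ℤ.* k ℤ.* s))
        lem₁ = ℤ-Solver.solve-∀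
        lem₂ : ∀ u x c n → u ℤ.* x ≡ u ℤ.* (x ℤ.- c ℤ.* n) ℤ.+ u ℤ.* c ℤ.* n
        lem₂ = ℤ-Solver.solve-∀
        lem₃ : ∀ z p a n u c → z ℤ.* (p ℤ.* (a ℤ.* n)) ℤ.+ u ℤ.* c ℤ.* (a ℤ.* n) ≡ a ℤ.* (n ℤ.* (u ℤ.* c ℤ.+ z ℤ.* p))
        lem₃ = ℤ-Solver.solve-∀

    conclude : + p ℤ.* + (N !) ∣ₗ + (p ^ j) ℤ.* X N K ℤ.- residue K j ℤ.* + (N !) →
      (∃₂ λ v u → N ! ≡ p ^ v * u × p ∤ u × digitSum p N + r * v ≡ N) →
      (∃₂ λ v u → K ! ≡ p ^ v * u × p ∤ u × digitSum p K + r * v ≡ K) →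
      Σ ℕ λ v → IsPAdicVal p s v × v * r + digitSum p N ≡ digitSum p K
    conclude (over u p∤u (ℤ∣.divides z law)) (vN , uN , N!-eq , p∤uN , N-sum) (vK , uK , K!-eq , p∤uK , K-sum)
      with v , v-eq , p^v∣s , p^∤s ← valuation-from-units (j + vK) vN (p∤* p∤u p∤uK)
             (p∤y {u} {z} {uN} p∤u p∤uN) (balance u z law vN uN N!-eq vK uK K!-eq) =
      -- Both Legendre formulas are compared through `N = K + r * j`; adding `r * (j + vK)` to both
      -- sides keeps the computation free of subtraction.
      v , (p^v∣s , p^∤s) , ℕₚ.+-cancelʳ-≡ (r * (j + vK)) _ _ (begin
        v * r + digitSum p N + r * (j + vK)  ≡⟨ lem v r (digitSum p N) (j + vK) ⟩
        digitSum p N + r * (j + vK + v)      ≡⟨ cong (λ q → digitSum p N + r * q) v-eq ⟩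
        digitSum p N + r * vN                ≡⟨ N-sum ⟩
        K + r * j                            ≡⟨ cong (_+ r * j) K-sum ⟨
        digitSum p K + r * vK + r * j        ≡⟨ lem′ (digitSum p K) r vK j ⟩
        digitSum p K + r * (j + vK)          ∎)

  -- The digit-sum formula for `k = a * p ^ h`.

  minimum-zero-case : ∀ a h → 1 ≤ a → a ≤ r → ∀ k → k ≡ a * p ^ h →
    ∀ n → k ≤ n → n < k * p → r ∣ n ∸ k →
    Σ ℕ λ v → IsPAdicVal p (stirling1 n k) v × v * r + digitSum p (n ∸ 1) ≡ digitSum p (k ∸ 1)
  minimum-zero-case a h 1≤a a≤r zero    k-eq n k≤n n<kp r∣ = contradiction n<kp λ ()
  minimum-zero-case a h 1≤a a≤r (suc K) k-eq n k≤n n<kp (divides j n∸k) =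
    subst (λ n → Σ ℕ λ v → IsPAdicVal p (stirling1 n (suc K)) v × v * r + digitSum p (n ∸ 1) ≡ digitSum p K)
      (sym n-eq) (stirling1-valuation K j (p∤choose {a} {h} (s≤s a≤r) k-eq j j≤K))
    where
    n-eq : n ≡ suc (K + r * j)
    n-eq = trans (sym (ℕₚ.m+[n∸m]≡n k≤n)) (trans (cong (λ x → suc K + x) n∸k) (cong (λ x → suc K + x) (ℕₚ.*-comm j r)))
    -- Since `k * p = k + r * k`, the bound `n < k * p` amounts to `r * j < r * k`, that is
    -- `j < suc K`.
    j≤K : j ≤ K
    j≤K = ℕₚ.≤-pred (ℕₚ.*-cancelˡ-< r j (suc K) (ℕₚ.+-cancelˡ-< (suc K) (r * j) (r * suc K)
      (subst (suc K + r * j <_) (lem K r) (subst (_< suc K * p) n-eq n<kp))))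
      where
      lem : ∀ K r → suc K * suc r ≡ suc K + r * suc K
      lem = ℕ-Solver.solve-∀

theorem3p2 : (p : ℕ) → .{{_ : NonZero p}} → Prime p →
    (a h : ℕ) → 1 ≤ a → a ≤ p ∸ 1 →
    (n : ℕ) → a * p ^ h ≤ n → n < (a * p ^ h) * p → (p ∸ 1) ∣ (n ∸ a * p ^ h) →
    Σ ℕ (λ v → IsPAdicVal p (stirling1 n (a * p ^ h)) v ×
    (v * (p ∸ 1) + digitSum p (n ∸ 1) ≡ digitSum p (a * p ^ h ∸ 1)))
theorem3p2 (suc r) p-prime a h 1≤a a≤r n =
  AtPrime.minimum-zero-case r p-prime a h 1≤a a≤r (a * suc r ^ h) refl n
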